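{- For every integer $k\ge 3$, the integer $g(k)$ exists and satisfies $2k-2\le g(k)\le 8k^2+1$. Moreover, $g(3)=5$ and $g(4)=8$.
   Context: A Gallai $k$-coloring of the complete graph $K_n$ is an assignment of one of the colors $1,\dots,k$ to each edge of $K_n$ (adjacent edges may have the same color) such that no triangle has its three edges colored with three pairwise different colors. For an integer $k\ge 3$, $g(k)$ denotes the smallest positive integer $m$ with the following property: for every integer $n\ge m$ and every $k$-partition $e_1,\dots,e_k$ of $\binom{n}{2}$ (that is, all positive integers $e_1,\dots,e_k$ with $\sum_{i=1}^k e_i=\binom{n}{2}$), there is a Gallai $k$-coloring of $K_n$ with exactly $e_i$ edges of color $i$ for each $1\le i\le k$. -}

module Defs where

open import Data.Nat.Base using (ℕ; _≤_; _<_)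
open import Data.Nat.Combinatorics using (_C_)
open import Data.Fin.Base using (Fin)
open import Data.Fin.Properties using (_≟_; _<?_)
open import Data.List.Base using (List; length; filter; allFin; cartesianProduct)
open import Data.Vec.Base using (Vec; lookup; sum)
open import Data.Vec.Relation.Unary.All using (All)
open import Data.Product.Base using (_×_; _,_; ∃-syntax)
open import Relation.Nullary.Negation.Core using (¬_)
open import Relation.Binary.PropositionalEquality.Core using (_≡_; _≢_)

edges : ∀ n → List (Fin n × Fin n)
edges n = filter (λ (x , y) → x <? y) (cartesianProduct (allFin n) (allFin n))

-- The edge {x, y} has color `color x y`; the values `color x x` carry no
-- meaning and are never consulted below.
record Coloring (k n : ℕ) : Set where
  field
    color     : Fin n → Fin n → Fin k
    symmetric : ∀ x y → color x y ≡ color y x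

open Coloring public

Rainbow : ∀ {k n} → Coloring k n → (x y z : Fin n) → Set
Rainbow c x y z =
  color c x y ≢ color c y z × color c y z ≢ color c x z × color c x y ≢ color c x z

IsGallai : ∀ {k n} → Coloring k n → Set
IsGallai c = ∀ x y z → x ≢ y → y ≢ z → x ≢ z → ¬ Rainbow c x y z

edgeCount : ∀ {k n} → Coloring k n → Fin k → ℕ
edgeCount {n = n} c i = length (filter (λ (x , y) → color c x y ≟ i) (edges n))

IsPartition : ∀ {k} → ℕ → Vec ℕ k → Set
IsPartition N e = All (0 <_) e × sum e ≡ N

Realizable : ∀ {k} → ℕ → Vec ℕ k → Set
Realizable {k} n e =
  ∃[ c ] IsGallai {k} {n} c × (∀ i → edgeCount c i ≡ lookup e i)

RealizableFrom : (k m : ℕ) → Set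
RealizableFrom k m =
  ∀ n → m ≤ n → (e : Vec ℕ k) → IsPartition (n C 2) e → Realizable n e

-- `IsG k m` says that g(k) exists and equals m.  The number g(k) is a relation
-- rather than a function because its existence is part of what is claimed.
record IsG (k m : ℕ) : Set where
  field
    positive   : 0 < m
    realizable : RealizableFrom k m
    least      : ∀ m′ → 0 < m′ → RealizableFrom k m′ → m ≤ m′

{-# OPTIONS --safe #-}
module Submission where

-- Upper bounds.  If one color joins two Gallai-colored vertex sets, the result is
-- Gallai, so all constructions are iterated joins.  While n ≥ 2 k, the largest
-- class contains a star at some vertex, which reduces n by one.  At n = 8 k² + 1
-- a smallest class is emptied instead: a few stars make it small enough to fit
-- into one block of 4 k + 1 vertices, whose remaining edges are taken from a
-- largest class, and k - 1 colors are left.  For k = 3, 4 the least n is settled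
-- by a search over such joins.  Since it is decidable which n are good, a bound
-- yields a least one.
--
-- Lower bounds.  Some color of a Gallai coloring is connected and hence has at
-- least n - 1 edges, and if the edges outside color p connect the vertices, then
-- a color other than p does.  This excludes the sizes (1, n - 2, …, n - 2) for
-- n = 2 k - 3, (2, 2, 2) for n = 4 and (9, 4, 4, 4) for n = 7.

open import Defs
open import Data.Bool.Base using (Bool; true; false; if_then_else_; T; _∧_; _∨_)
open import Data.Bool.ListAction using (any)
import Data.Bool.Properties as Boolₚ
open import Data.Empty using (⊥)
open import Data.Fin.Base as Fin using (Fin; zero; suc; splitAt; _↑ˡ_; _↑ʳ_; toℕ; fromℕ<; finToFun; funToFin)
open import Data.Fin.Properties as Finₚ using (_≟_; _<?_)
open import Data.List.Base using (List; []; _∷_; [_]; _++_; map; length; filter; allFin; cartesianProduct; concatMap; tabulate)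
open import Data.List.Membership.Propositional using (_∈_; find; lose)
open import Data.List.Membership.Propositional.Properties using (∈-map⁻; ∈-concatMap⁻; ∈-++⁺ˡ; ∈-++⁺ʳ; ∈-++⁻)
import Data.List.Properties as Listₚ
open import Data.List.Relation.Binary.Permutation.Propositional as ↭
  using (_↭_; prep; swap; ↭-sym; ↭-trans; module PermutationReasoning)
open import Data.List.Relation.Binary.Permutation.Propositional.Properties as ↭ₚ using (↭-length; All-resp-↭; ∈-resp-↭)
open import Data.List.Relation.Unary.All as All using (All; []; _∷_)
import Data.List.Relation.Unary.All.Properties as Allₚ
open import Data.List.Relation.Unary.AllPairs using (AllPairs; []; _∷_)
import Data.List.Relation.Unary.AllPairs.Properties as AllPairsₚ
open import Data.List.Relation.Unary.Any as Any using (here; there)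
import Data.List.Relation.Unary.Any.Properties as Anyₚ
open import Data.Nat.Base using (ℕ; zero; suc; _≤_; _<_; _+_; _*_; _∸_; _^_; _≤ᵇ_; _≡ᵇ_; z≤n; s≤s; z<s)
open import Data.Nat.Combinatorics using (_C_; nC1≡n; nCk+nC[k+1]≡[n+1]C[k+1])
import Data.Nat.Properties as ℕₚ
open import Data.Nat.Tactic.RingSolver using (solve-∀)
open import Data.Product.Base using (_×_; _,_; ∃-syntax; proj₁; proj₂)
open import Data.Sum.Base using (_⊎_; inj₁; inj₂; [_,_]′)
open import Data.Unit.Base using (tt)
open import Data.Vec.Base as Vec using (Vec; []; _∷_; lookup)
import Data.Vec.Properties as Vecₚ
open import Data.Vec.Relation.Unary.All as VecAll using ([]; _∷_)
open import Function.Base using (_∘_; flip; id)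
open import Function.Bundles using (Equivalence)
open import Relation.Binary.Definitions using (Total; Transitive)
open import Relation.Binary.PropositionalEquality
  using (_≡_; _≢_; refl; sym; trans; cong; cong₂; subst; module ≡-Reasoning)
open import Relation.Nullary using (¬_; yes; no; does; contradiction; Dec; ¬?; _×-dec_; _→-dec_)
open import Relation.Nullary.Decidable using (decidable-stable; map′)

private
  variable
    A V : Set
    k n : ℕ

  swap-+ : ∀ x y z → x + (y + z) ≡ y + (x + z)
  swap-+ = solve-∀

  interchange-+ : ∀ a b c d → (a + b) + (c + d) ≡ (a + c) + (b + d)
  interchange-+ = solve-∀

  suc-out : ∀ x y z → x + (y + suc z) ≡ suc (x + (y + z))
  suc-out = solve-∀

-- Counting the edges of a color

module _ (c : A → A → Fin k) (i : Fin k) where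

  degree : A → List A → ℕ
  degree x ys = length (filter (λ y → c x y ≟ i) ys)

  crossCount : List A → List A → ℕ
  crossCount []       ys = 0
  crossCount (x ∷ xs) ys = degree x ys + crossCount xs ys

  -- Recursion over the vertex list replaces the filter in `edges`, so that the count can be split
  -- along `++`, as a join requires.
  pairCount : List A → ℕ
  pairCount []       = 0
  pairCount (x ∷ xs) = degree x xs + pairCount xs

  degree-++ : ∀ x ys zs → degree x (ys ++ zs) ≡ degree x ys + degree x zs
  degree-++ x ys zs = trans (cong length (Listₚ.filter-++ _ ys zs)) (Listₚ.length-++ (filter _ ys))

  pairCount-++ : ∀ xs ys → pairCount (xs ++ ys) ≡ crossCount xs ys + (pairCount xs + pairCount ys)
  pairCount-++ []       ys = refl
  pairCount-++ (x ∷ xs) ys = begin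
    degree x (xs ++ ys) + pairCount (xs ++ ys)
      ≡⟨ cong₂ _+_ (degree-++ x xs ys) (pairCount-++ xs ys) ⟩
    (degree x xs + degree x ys) + (crossCount xs ys + (pairCount xs + pairCount ys))
      ≡⟨ shuffle (degree x xs) (degree x ys) _ _ _ ⟩
    (degree x ys + crossCount xs ys) + ((degree x xs + pairCount xs) + pairCount ys) ∎
    where
    open ≡-Reasoning
    shuffle : ∀ a b c d e → (a + b) + (c + (d + e)) ≡ (b + c) + ((a + d) + e)
    shuffle = solve-∀

module _ (c : A → A → Fin k) (d : V → V → Fin k) (f : A → V) (i : Fin k) where

  degree-map : ∀ x → (∀ y → c x y ≡ d (f x) (f y)) → ∀ ys → degree d i (f x) (map f ys) ≡ degree c i x ys
  degree-map x eq []       = refl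
  degree-map x eq (y ∷ ys) rewrite eq y with does (d (f x) (f y) ≟ i)
  ... | true  = cong suc (degree-map x eq ys)
  ... | false = degree-map x eq ys

  pairCount-map : (∀ x y → c x y ≡ d (f x) (f y)) → ∀ xs → pairCount d i (map f xs) ≡ pairCount c i xs
  pairCount-map eq []       = refl
  pairCount-map eq (x ∷ xs) = cong₂ _+_ (degree-map x (eq x) xs) (pairCount-map eq xs)

pairs : List A → List (A × A)
pairs []       = []
pairs (x ∷ xs) = map (x ,_) xs ++ pairs xs

filter-pairs : (c : A → A → Fin k) (i : Fin k) (xs : List A) →
               length (filter (λ (x , y) → c x y ≟ i) (pairs xs)) ≡ pairCount c i xs
filter-pairs c i []       = refl
filter-pairs c i (x ∷ xs) = begin
  length (filter P (map (x ,_) xs ++ pairs xs))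
    ≡⟨ cong length (Listₚ.filter-++ P (map (x ,_) xs) (pairs xs)) ⟩
  length (filter P (map (x ,_) xs) ++ filter P (pairs xs))
    ≡⟨ Listₚ.length-++ (filter P (map (x ,_) xs)) ⟩
  length (filter P (map (x ,_) xs)) + length (filter P (pairs xs))
    ≡⟨ cong₂ _+_ (row xs) (filter-pairs c i xs) ⟩
  degree c i x xs + pairCount c i xs ∎
  where
  open ≡-Reasoning
  P = λ ((x , y) : _ × _) → c x y ≟ i
  row : ∀ ys → length (filter P (map (x ,_) ys)) ≡ degree c i x ys
  row []       = refl
  row (y ∷ ys) with does (c x y ≟ i)
  ... | true  = cong suc (row ys)
  ... | false = row ys

private
  increasing? : (p : Fin n × Fin n) → _
  increasing? (x , y) = x <? y

-- The extra column consists of pairs `(y , x)` with `x` below `y`, and the filter rejects all of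
-- them.
filter-product-∷ : ∀ (x : Fin n) ys zs → All (x Fin.<_) ys →
  filter increasing? (cartesianProduct ys (x ∷ zs)) ≡ filter increasing? (cartesianProduct ys zs)
filter-product-∷ x []       zs []           = refl
filter-product-∷ x (y ∷ ys) zs (x<y ∷ x<ys) = begin
  filter increasing? ((y , x) ∷ map (y ,_) zs ++ cartesianProduct ys (x ∷ zs))
    ≡⟨ Listₚ.filter-reject increasing? (ℕₚ.<-asym x<y) ⟩
  filter increasing? (map (y ,_) zs ++ cartesianProduct ys (x ∷ zs))
    ≡⟨ Listₚ.filter-++ increasing? (map (y ,_) zs) _ ⟩
  filter increasing? (map (y ,_) zs) ++ filter increasing? (cartesianProduct ys (x ∷ zs))
    ≡⟨ cong (filter increasing? (map (y ,_) zs) ++_) (filter-product-∷ x ys zs x<ys) ⟩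
  filter increasing? (map (y ,_) zs) ++ filter increasing? (cartesianProduct ys zs)
    ≡⟨ Listₚ.filter-++ increasing? (map (y ,_) zs) _ ⟨
  filter increasing? (map (y ,_) zs ++ cartesianProduct ys zs) ∎
  where open ≡-Reasoning

filter-product : ∀ {xs : List (Fin n)} → AllPairs Fin._<_ xs →
                 filter increasing? (cartesianProduct xs xs) ≡ pairs xs
filter-product []                        = refl
filter-product {xs = x ∷ xs} (x<xs ∷ <s) = begin
  filter increasing? ((x , x) ∷ map (x ,_) xs ++ cartesianProduct xs (x ∷ xs))
    ≡⟨ Listₚ.filter-reject increasing? (Finₚ.<-irrefl {x = x} refl) ⟩
  filter increasing? (map (x ,_) xs ++ cartesianProduct xs (x ∷ xs))
    ≡⟨ Listₚ.filter-++ increasing? (map (x ,_) xs) _ ⟩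
  filter increasing? (map (x ,_) xs) ++ filter increasing? (cartesianProduct xs (x ∷ xs))
    ≡⟨ cong₂ _++_ (Listₚ.filter-all increasing? (Allₚ.map⁺ x<xs))
                  (trans (filter-product-∷ x xs xs x<xs) (filter-product <s)) ⟩
  map (x ,_) xs ++ pairs xs ∎
  where open ≡-Reasoning

edgeCount-pairCount : (c : Coloring k n) (i : Fin k) → edgeCount c i ≡ pairCount (color c) i (allFin n)
edgeCount-pairCount {n = n} c i =
  trans (cong (length ∘ filter _) (filter-product (AllPairsₚ.tabulate⁺-< {f = λ (x : Fin n) → x} (λ x<y → x<y))))
        (filter-pairs (color c) i (allFin n))

tabulate-+ : ∀ m n (f : Fin (m + n) → A) →
             tabulate f ≡ tabulate (f ∘ (_↑ˡ n)) ++ tabulate (f ∘ (m ↑ʳ_))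
tabulate-+ zero    n f = refl
tabulate-+ (suc m) n f = cong (f zero ∷_) (tabulate-+ m n (f ∘ suc))

allFin-+ : ∀ m n → allFin (m + n) ≡ map (_↑ˡ n) (allFin m) ++ map (m ↑ʳ_) (allFin n)
allFin-+ m n = trans (tabulate-+ m n (λ x → x))
  (sym (cong₂ _++_ (Listₚ.map-tabulate (λ x → x) (_↑ˡ n)) (Listₚ.map-tabulate (λ x → x) (m ↑ʳ_))))

-- Colorings built by joins

-- The decomposition tree of a cograph, with `k` colors at the inner nodes in place of the usual
-- two. The leaves are the vertices, and an edge gets the color of the node at which its ends
-- separate.
data Cotree (k : ℕ) : Set where
  leaf : Cotree k
  join : Fin k → Cotree k → Cotree k → Cotree k

size : Cotree k → ℕ
size leaf         = 1
size (join j s t) = size s + size t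

single : Fin k → ℕ → Fin k → ℕ
single j a i = if does (j ≟ i) then a else 0

count : Cotree k → Fin k → ℕ
count leaf         i = 0
count (join j s t) i = single j (size s * size t) i + (count s i + count t i)

module _ (d : Fin k) where

  -- d is the meaningless color of the loop at a leaf.
  cotreeColor : (t : Cotree k) → Fin (size t) → Fin (size t) → Fin k
  joinColor   : Fin k → (s t : Cotree k) →
                Fin (size s) ⊎ Fin (size t) → Fin (size s) ⊎ Fin (size t) → Fin k
  cotreeColor leaf         x y = d
  cotreeColor (join j s t) x y = joinColor j s t (splitAt (size s) x) (splitAt (size s) y)
  joinColor j s t (inj₁ x) (inj₁ y) = cotreeColor s x y
  joinColor j s t (inj₁ x) (inj₂ y) = j
  joinColor j s t (inj₂ x) (inj₁ y) = j
  joinColor j s t (inj₂ x) (inj₂ y) = cotreeColor t x y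

  cotreeColor-sym : ∀ t x y → cotreeColor t x y ≡ cotreeColor t y x
  cotreeColor-sym leaf         x y = refl
  cotreeColor-sym (join j s t) x y with splitAt (size s) x | splitAt (size s) y
  ... | inj₁ x | inj₁ y = cotreeColor-sym s x y
  ... | inj₁ x | inj₂ y = refl
  ... | inj₂ x | inj₁ y = refl
  ... | inj₂ x | inj₂ y = cotreeColor-sym t x y

  cotreeColoring : (t : Cotree k) → Coloring k (size t)
  cotreeColoring t = record { color = cotreeColor t ; symmetric = cotreeColor-sym t }

  -- If the three vertices do not lie on the same side of a join, two of the three edges cross it
  -- and share the color `j`.
  cotreeColor-gallai : ∀ t x y z → ¬ Rainbow (cotreeColoring t) x y z
  cotreeColor-gallai leaf         x y z (p , _) = p refl
  cotreeColor-gallai (join j s t) x y z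
    with splitAt (size s) x | splitAt (size s) y | splitAt (size s) z
  ... | inj₁ x | inj₁ y | inj₁ z = cotreeColor-gallai s x y z
  ... | inj₁ x | inj₁ y | inj₂ z = λ (_ , q , _) → q refl
  ... | inj₁ x | inj₂ y | inj₁ z = λ (p , _ , _) → p refl
  ... | inj₁ x | inj₂ y | inj₂ z = λ (_ , _ , r) → r refl
  ... | inj₂ x | inj₁ y | inj₁ z = λ (_ , _ , r) → r refl
  ... | inj₂ x | inj₁ y | inj₂ z = λ (p , _ , _) → p refl
  ... | inj₂ x | inj₂ y | inj₁ z = λ (_ , q , _) → q refl
  ... | inj₂ x | inj₂ y | inj₂ z = cotreeColor-gallai t x y z

degree-const : (c : A → A → Fin k) (i j : Fin k) (x : A) (ys : List A) →
               All (λ y → c x y ≡ j) ys → degree c i x ys ≡ single j (length ys) i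
degree-const c i j x ys eqs with j ≟ i
... | yes refl = cong length (Listₚ.filter-all _ eqs)
... | no j≢i  = cong length (Listₚ.filter-none _ (All.map (λ { refl → j≢i }) eqs))

single-+ : ∀ (j i : Fin k) a b → single j a i + single j b i ≡ single j (a + b) i
single-+ j i a b with does (j ≟ i)
... | true  = refl
... | false = refl

crossCount-const : (c : A → A → Fin k) (i j : Fin k) (xs ys : List A) →
                   All (λ x → All (λ y → c x y ≡ j) ys) xs →
                   crossCount c i xs ys ≡ single j (length xs * length ys) i
crossCount-const c i j []       ys [] with does (j ≟ i)
... | true  = refl
... | false = refl
crossCount-const c i j (x ∷ xs) ys (eq ∷ eqs) =
  trans (cong₂ _+_ (degree-const c i j x ys eq) (crossCount-const c i j xs ys eqs)) (single-+ j i _ _)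

cotree-pairCount : ∀ (d : Fin k) t i → pairCount (cotreeColor d t) i (allFin (size t)) ≡ count t i
cotree-pairCount d leaf         i = refl
cotree-pairCount d (join j s t) i = begin
  pairCount col i (allFin (size s + size t))
    ≡⟨ cong (pairCount col i) (allFin-+ (size s) (size t)) ⟩
  pairCount col i (L ++ R)
    ≡⟨ pairCount-++ col i L R ⟩
  crossCount col i L R + (pairCount col i L + pairCount col i R)
    ≡⟨ cong₂ _+_ cross (cong₂ _+_ left right) ⟩
  single j (size s * size t) i + (count s i + count t i) ∎
  where
  open ≡-Reasoning
  col = cotreeColor d (join j s t)
  inˡ = λ (x : Fin (size s)) → x ↑ˡ size t
  inʳ = λ (x : Fin (size t)) → size s ↑ʳ x
  L = map inˡ (allFin (size s))
  R = map inʳ (allFin (size t))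
  length-map-allFin : ∀ {m n} (f : Fin m → Fin n) → length (map f (allFin m)) ≡ m
  length-map-allFin f = trans (Listₚ.length-map f (allFin _)) (Listₚ.length-tabulate _)
  mixed : ∀ x y → col (inˡ x) (inʳ y) ≡ j
  mixed x y rewrite Finₚ.splitAt-↑ˡ (size s) x (size t) | Finₚ.splitAt-↑ʳ (size s) (size t) y = refl
  cross : crossCount col i L R ≡ single j (size s * size t) i
  cross = trans
    (crossCount-const col i j L R
      (Allₚ.map⁺ (All.universal (λ x → Allₚ.map⁺ (All.universal (mixed x) _)) _)))
    (cong₂ (λ a b → single j (a * b) i) (length-map-allFin inˡ) (length-map-allFin inʳ))
  eqˡ : ∀ x y → cotreeColor d s x y ≡ col (inˡ x) (inˡ y)
  eqˡ x y rewrite Finₚ.splitAt-↑ˡ (size s) x (size t) | Finₚ.splitAt-↑ˡ (size s) y (size t) = refl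
  eqʳ : ∀ x y → cotreeColor d t x y ≡ col (inʳ x) (inʳ y)
  eqʳ x y rewrite Finₚ.splitAt-↑ʳ (size s) (size t) x | Finₚ.splitAt-↑ʳ (size s) (size t) y = refl
  left : pairCount col i L ≡ count s i
  left = trans (pairCount-map _ col inˡ i eqˡ (allFin (size s))) (cotree-pairCount d s i)
  right : pairCount col i R ≡ count t i
  right = trans (pairCount-map _ col inʳ i eqʳ (allFin (size t))) (cotree-pairCount d t i)

-- Class sizes are compared pointwise, so that they can be rewritten without function
-- extensionality.
Built : ∀ {k} → ℕ → (Fin k → ℕ) → Set
Built {k} n f = ∃[ t ] size {k} t ≡ n × (∀ i → count t i ≡ f i)

built⇒realizable : ∀ {n} (e : Vec ℕ (suc k)) → Built n (lookup e) → Realizable n e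
built⇒realizable e (t , refl , eq) = c , (λ x y z _ _ _ → cotreeColor-gallai zero t x y z) ,
  λ i → trans (edgeCount-pairCount c i) (trans (cotree-pairCount zero t i) (eq i))
  where c = cotreeColoring zero t

triangle : ℕ → ℕ
triangle zero    = 0
triangle (suc n) = n + triangle n

C2≡triangle : ∀ n → n C 2 ≡ triangle n
C2≡triangle zero    = refl
C2≡triangle (suc n) = trans (sym (nCk+nC[k+1]≡[n+1]C[k+1] n 1)) (cong₂ _+_ (nC1≡n n) (C2≡triangle n))

triangle-+ : ∀ m n → triangle (m + n) ≡ m * n + (triangle m + triangle n)
triangle-+ zero    n = refl
triangle-+ (suc m) n = trans (cong (m + n +_) (triangle-+ m n)) (shuffle m n (m * n) _ _)
  where
  shuffle : ∀ m n p s t → m + n + (p + (s + t)) ≡ n + p + (m + s + t)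
  shuffle = solve-∀

2*triangle : ∀ n → 2 * triangle (suc n) ≡ suc n * n
2*triangle zero    = refl
2*triangle (suc n) = begin
  2 * (suc n + triangle (suc n))     ≡⟨ ℕₚ.*-distribˡ-+ 2 (suc n) _ ⟩
  2 * suc n + 2 * triangle (suc n)   ≡⟨ cong (2 * suc n +_) (2*triangle n) ⟩
  2 * suc n + suc n * n              ≡⟨ factor n ⟩
  suc (suc n) * suc n                ∎
  where
  open ≡-Reasoning
  factor : ∀ n → 2 * suc n + suc n * n ≡ suc (suc n) * suc n
  factor = solve-∀

built-≗ : ∀ {f g : Fin k → ℕ} → (∀ i → f i ≡ g i) → Built n f → Built n g
built-≗ f≗g (t , st , ct) = t , st , λ i → trans (ct i) (f≗g i)

built-leaf : Built {k} 1 (λ _ → 0)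
built-leaf = leaf , refl , λ _ → refl

built-join : ∀ j {m n} {f g : Fin k → ℕ} → Built m f → Built n g →
             Built (m + n) (λ i → single j (m * n) i + (f i + g i))
built-join j (s , refl , cs) (t , refl , ct) = join j s t , refl ,
  λ i → cong (single j (size s * size t) i +_) (cong₂ _+_ (cs i) (ct i))

built-star : ∀ j {f : Fin k → ℕ} → Built n f → Built (suc n) (λ i → single j n i + f i)
built-star {n = n} j b = built-≗ (λ i → cong (λ a → single j a i + _) (ℕₚ.*-identityˡ n)) (built-join j built-leaf b)

single-0 : ∀ (j i : Fin k) → single j 0 i ≡ 0
single-0 j i with does (j ≟ i)
... | true  = refl
... | false = refl

-- Greedy choice of stars: a spanning star takes color `i` if `a` allows it. Otherwise `a` is so
-- small that the graph without one vertex can hold it, and `b` pays for the star. The two colors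
-- may coincide.
built-twoColored : ∀ (i j : Fin k) n a b → a + b ≡ triangle (suc n) →
                   Built (suc n) (λ l → single i a l + single j b l)
built-twoColored i j zero    zero    zero eq = built-≗ (λ l → sym (cong₂ _+_ (single-0 i l) (single-0 j l))) built-leaf
built-twoColored i j (suc n) a b eq with suc n ℕₚ.≤? a
... | yes n<a with ℕₚ.m≤n⇒∃[o]m+o≡n n<a
...   | a′ , refl = built-≗
        (λ l → trans (sym (ℕₚ.+-assoc (single i (suc n) l) _ _)) (cong (_+ _) (single-+ i l (suc n) a′)))
        (built-star i (built-twoColored i j n a′ b
          (ℕₚ.+-cancelˡ-≡ (suc n) _ _ (trans (sym (ℕₚ.+-assoc (suc n) a′ b)) eq))))
built-twoColored i j (suc n) a b eq | no n≮a
  with ℕₚ.m≤n⇒∃[o]m+o≡n (ℕₚ.≤-trans (ℕₚ.≤-pred (ℕₚ.≰⇒> n≮a)) (ℕₚ.m≤m+n n (triangle n)))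
... | b′ , a+b′≡ = built-≗
        (λ l → trans (swap-+ (single j (suc n) l) (single i a l) (single j b′ l))
                       (cong (single i a l +_) (trans (single-+ j l (suc n) b′) (cong (λ x → single j x l) (sym b≡)))))
        (built-star j (built-twoColored i j n a b′ a+b′≡))
  where
  b≡ : b ≡ suc n + b′
  b≡ = ℕₚ.+-cancelˡ-≡ a _ _ (trans eq (trans (cong (suc n +_) (sym a+b′≡)) (swap-+ (suc n) a b′)))

amount : List (Fin k × ℕ) → Fin k → ℕ
amount []             i = 0
amount ((j , a) ∷ es) i = single j a i + amount es i

total : List (Fin k × ℕ) → ℕ
total []             = 0
total ((_ , a) ∷ es) = a + total es

amount-↭ : ∀ {es es′ : List (Fin k × ℕ)} → es ↭ es′ → ∀ i → amount es i ≡ amount es′ i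
amount-↭ ↭.refl                     i = refl
amount-↭ (prep (j , a) p)           i = cong (single j a i +_) (amount-↭ p i)
amount-↭ {es = _ ∷ _ ∷ es} (swap (j , a) (l , b) p) i =
  trans (swap-+ (single j a i) (single l b i) (amount es i)) (cong (λ x → single l b i + (single j a i + x)) (amount-↭ p i))
amount-↭ (↭.trans p q)              i = trans (amount-↭ p i) (amount-↭ q i)

total-↭ : ∀ {es es′ : List (Fin k × ℕ)} → es ↭ es′ → total es ≡ total es′
total-↭ ↭.refl                     = refl
total-↭ (prep (j , a) p)           = cong (a +_) (total-↭ p)
total-↭ {es = _ ∷ _ ∷ es} (swap (j , a) (l , b) p) = trans (swap-+ a b (total es)) (cong (λ x → b + (a + x)) (total-↭ p))
total-↭ (↭.trans p q)              = trans (total-↭ p) (total-↭ q)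

total-≤ : ∀ {b} {es : List (Fin k × ℕ)} → All (λ e → proj₂ e ≤ b) es → total es ≤ length es * b
total-≤ []         = z≤n
total-≤ (p ∷ ps) = ℕₚ.+-mono-≤ p (total-≤ ps)

total-≥ : ∀ {a} {es : List (Fin k × ℕ)} → All (λ e → a ≤ proj₂ e) es → length es * a ≤ total es
total-≥ []         = z≤n
total-≥ (p ∷ ps) = ℕₚ.+-mono-≤ p (total-≥ ps)

extractMin : ∀ {_≼_ : A → A → Set} → Total _≼_ → Transitive _≼_ → ∀ x xs →
             ∃[ y ] ∃[ ys ] (x ∷ xs ↭ y ∷ ys) × All (y ≼_) ys
extractMin ≼-total ≼-trans x []        = x , [] , ↭.refl , []
extractMin ≼-total ≼-trans x (x′ ∷ xs) with extractMin ≼-total ≼-trans x′ xs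
... | y , ys , p , y≼ys with ≼-total x y
...   | inj₁ x≼y = x , y ∷ ys , prep x p , x≼y ∷ All.map (≼-trans x≼y) y≼ys
...   | inj₂ y≼x = y , x ∷ ys , ↭.trans (prep x p) (swap x y ↭.refl) , y≼x ∷ y≼ys

extractSmallest : ∀ (e : Fin k × ℕ) es → ∃[ j ] ∃[ a ] ∃[ es′ ]
                  (e ∷ es ↭ (j , a) ∷ es′) × All (λ e′ → a ≤ proj₂ e′) es′
extractSmallest e es with extractMin {_≼_ = λ x y → proj₂ x ≤ proj₂ y} (λ _ _ → ℕₚ.≤-total _ _) ℕₚ.≤-trans e es
... | (j , a) , es′ , p , q = j , a , es′ , p , q

extractLargest : ∀ (e : Fin k × ℕ) es → ∃[ j ] ∃[ b ] ∃[ es′ ]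
                 (e ∷ es ↭ (j , b) ∷ es′) × All (λ e′ → proj₂ e′ ≤ b) es′
extractLargest e es
  with extractMin {_≼_ = λ x y → proj₂ y ≤ proj₂ x} (λ _ _ → ℕₚ.≤-total _ _) (flip ℕₚ.≤-trans) e es
... | (j , a) , es′ , p , q = j , a , es′ , p , q

built-∷-star : ∀ (j : Fin k) a {n} es → Built n (amount ((j , a) ∷ es)) → Built (suc n) (amount ((j , n + a) ∷ es))
built-∷-star j a {n} es b = built-≗
  (λ i → trans (sym (ℕₚ.+-assoc (single j n i) _ _)) (cong (_+ _) (single-+ j i n a)))
  (built-star j b)

-- The upper bound 8 k² + 1

-- A largest class has at least the average size, which is at least `n` because the number of
-- classes is at most half of `suc n`. It therefore pays for a star joining one vertex to the other
-- `n`. The number of entries stays the same, though one may become zero.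
reduceByStar : ∀ (e : Fin k × ℕ) es n → 2 * suc (length es) ≤ suc n → total (e ∷ es) ≡ triangle (suc n) →
               (∀ (e′ : Fin k × ℕ) es′ → length es′ ≡ length es → total (e′ ∷ es′) ≡ triangle n → Built n (amount (e′ ∷ es′))) →
               Built (suc n) (amount (e ∷ es))
reduceByStar e es n 2k≤n+1 tot rec with extractLargest e es
... | j , b , es′ , p , es′≤b with ℕₚ.m≤n⇒∃[o]m+o≡n n≤b
  where
  open ℕₚ.≤-Reasoning
  k′ = suc (length es)
  n≤b : n ≤ b
  n≤b = ℕₚ.*-cancelˡ-≤ (2 * k′) (begin
    2 * k′ * n             ≤⟨ ℕₚ.*-monoˡ-≤ n 2k≤n+1 ⟩
    suc n * n              ≡⟨ 2*triangle n ⟨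
    2 * triangle (suc n)   ≡⟨ cong (2 *_) (trans (sym tot) (total-↭ p)) ⟩
    2 * (b + total es′)    ≤⟨ ℕₚ.*-monoʳ-≤ 2 (total-≤ {es = (j , b) ∷ es′} (ℕₚ.≤-refl ∷ es′≤b)) ⟩
    2 * (suc (length es′) * b) ≡⟨ cong (λ x → 2 * (x * b)) (sym (↭-length p)) ⟩
    2 * (k′ * b)           ≡⟨ ℕₚ.*-assoc 2 k′ b ⟨
    2 * k′ * b             ∎)
... | b′ , refl = built-≗ (λ i → sym (amount-↭ p i)) (built-∷-star j b′ es′
  (rec (j , b′) es′ (ℕₚ.suc-injective (sym (↭-length p)))
    (ℕₚ.+-cancelˡ-≡ n _ _ (trans (trans (sym (ℕₚ.+-assoc n b′ _)) (sym (total-↭ p))) tot))))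

-- A smallest class of size a ≤ B is first reduced by at most p spanning stars
-- to at most triangle s edges, which then fit into a block of s vertices; all
-- other edges of the block and all edges leaving it come from a largest class.
module Step (j s′ r₀ p B : ℕ)
  (block-fits  : suc s′ * (r₀ + p) + triangle (suc s′) ≤ B)
  (star-fits   : suc s′ + (r₀ + p) ≤ suc (triangle (suc s′)))
  (peelable    : B ≤ triangle (suc s′) + p * (suc s′ + r₀))
  (average     : 2 * triangle (suc s′ + (r₀ + p)) ≡ 2 * (2 + j) * B)
  (few-classes : 2 * (2 + j) ≤ suc s′ + (r₀ + p))
  {k} (below : ∀ r (es : List (Fin k × ℕ)) → length es ≡ suc j → r₀ ≤ r → total es ≡ triangle r → Built r (amount es))
  where

  open ℕₚ.≤-Reasoning

  K s Δ F : ℕ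
  K = 2 + j
  s = suc s′
  Δ = triangle s
  F = s + (r₀ + p)

  module _ (i m : Fin k) (b : ℕ) (es : List (Fin k × ℕ)) (len : length es ≡ j) (B≤b : B ≤ b) where

    -- The block holds all of class `i`, filled up with `d` edges of color `m`, and is joined to the
    -- remaining `r₀ + f` vertices in color `m`. By `block-fits` the class of `m` can afford this.
    -- Class `i` is then empty, so `below` colors the rest with one entry fewer.
    splitBlock : ∀ f a → f ≤ p → a ≤ Δ → a + (b + total es) ≡ triangle (s + (r₀ + f)) →
                 Built (s + (r₀ + f)) (amount ((i , a) ∷ (m , b) ∷ es))
    splitBlock f a f≤p a≤Δ tot with ℕₚ.m≤n⇒∃[o]m+o≡n a≤Δ
    ... | d , a+d≡Δ with ℕₚ.m≤n⇒∃[o]m+o≡n (begin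
            s * (r₀ + f) + d  ≤⟨ ℕₚ.+-mono-≤ (ℕₚ.*-monoʳ-≤ s (ℕₚ.+-monoʳ-≤ r₀ f≤p))
                                             (ℕₚ.≤-trans (ℕₚ.m≤n+m d a) (ℕₚ.≤-reflexive a+d≡Δ)) ⟩
            s * (r₀ + p) + Δ  ≤⟨ block-fits ⟩
            B                 ≤⟨ B≤b ⟩
            b                 ∎)
    ... | b′ , refl = built-≗ eq (built-join m
            (built-twoColored i m s′ a d a+d≡Δ)
            (below r ((m , b′) ∷ es) (cong suc len) (ℕₚ.m≤m+n r₀ f) rest-total))
      where
      r = r₀ + f
      regroup : ∀ x a d y z → x + (a + d) + (y + z) ≡ a + (x + d + y + z)
      regroup = solve-∀
      rest-total : b′ + total es ≡ triangle r
      rest-total = ℕₚ.+-cancelˡ-≡ (s * r + Δ) _ _ (begin-equality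
        s * r + Δ + (b′ + total es)         ≡⟨ cong (λ x → s * r + x + (b′ + total es)) (sym a+d≡Δ) ⟩
        s * r + (a + d) + (b′ + total es)   ≡⟨ regroup (s * r) a d b′ (total es) ⟩
        a + (s * r + d + b′ + total es)     ≡⟨ tot ⟩
        triangle (s + r)                    ≡⟨ triangle-+ s r ⟩
        s * r + (Δ + triangle r)            ≡⟨ ℕₚ.+-assoc (s * r) Δ _ ⟨
        s * r + Δ + triangle r              ∎)
      regroup′ : ∀ x y z u v → x + (y + z + (u + v)) ≡ y + (x + z + u + v)
      regroup′ = solve-∀
      eq : ∀ l → single m (s * r) l + (single i a l + single m d l + amount ((m , b′) ∷ es) l)
               ≡ amount ((i , a) ∷ (m , s * r + d + b′) ∷ es) l
      eq l = trans (regroup′ (single m (s * r) l) (single i a l) (single m d l) (single m b′ l) (amount es l))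
                     (cong (λ x → single i a l + (x + amount es l))
                           (trans (cong (_+ _) (single-+ m l (s * r) d)) (single-+ m l (s * r + d) b′)))

    -- Here `f` is the number of stars still allowed. While `a` exceeds `Δ`, `star-fits` makes it
    -- large enough for a spanning star. Each star has at least `s + r₀` edges, so the bound on `a`
    -- survives and yields `a ≤ Δ` when no star is left. Only class `i` pays, hence `B ≤ b`
    -- persists.
    peel : ∀ f a → f ≤ p → a ≤ Δ + f * (s + r₀) → a + (b + total es) ≡ triangle (s + (r₀ + f)) →
           Built (s + (r₀ + f)) (amount ((i , a) ∷ (m , b) ∷ es))
    peel zero    a f≤p a≤ tot = splitBlock 0 a f≤p (subst (a ≤_) (ℕₚ.+-identityʳ Δ) a≤) tot
    peel (suc f) a f<p a≤ tot with a ℕₚ.≤? Δ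
    ... | yes a≤Δ = splitBlock (suc f) a f<p a≤Δ tot
    ... | no a≰Δ with ℕₚ.m≤n⇒∃[o]m+o≡n (ℕₚ.≤-pred (begin
            suc (s + (r₀ + f))  ≡⟨ suc-out s r₀ f ⟨
            s + (r₀ + suc f)    ≤⟨ ℕₚ.+-monoʳ-≤ s (ℕₚ.+-monoʳ-≤ r₀ f<p) ⟩
            F                   ≤⟨ star-fits ⟩
            suc Δ               ≤⟨ s≤s (ℕₚ.<⇒≤ (ℕₚ.≰⇒> a≰Δ)) ⟩
            suc a               ∎))
    ... | a′ , refl = subst (λ n → Built n (amount ((i , n′ + a′) ∷ (m , b) ∷ es))) (sym (suc-out s r₀ f))
            (built-∷-star i a′ ((m , b) ∷ es)
              (peel f a′ (ℕₚ.<⇒≤ f<p) a′≤ (ℕₚ.+-cancelˡ-≡ n′ _ _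
                (trans (sym (ℕₚ.+-assoc n′ a′ _)) (trans tot (cong triangle (suc-out s r₀ f)))))))
      where
      n′ = s + (r₀ + f)
      regroup : ∀ x y z a → x + y + (z + a) ≡ x + (y + z) + a
      regroup = solve-∀
      a′≤ : a′ ≤ Δ + f * (s + r₀)
      a′≤ = ℕₚ.≤-trans (ℕₚ.m≤n+m a′ f) (ℕₚ.+-cancelˡ-≤ (s + r₀) _ _ (begin
        s + r₀ + (f + a′)            ≡⟨ regroup s r₀ f a′ ⟩
        s + (r₀ + f) + a′            ≤⟨ a≤ ⟩
        Δ + (s + r₀ + f * (s + r₀))  ≡⟨ swap-+ Δ (s + r₀) _ ⟩
        s + r₀ + (Δ + f * (s + r₀))  ∎))

  -- On `F` vertices the average class size is exactly `B`, so a smallest class has at most `B`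
  -- edges and a largest at least `B`. The smallest is chosen after the largest is removed, so that
  -- they are different entries even if all sizes agree.
  atThreshold : ∀ e e′ (es : List (Fin k × ℕ)) → length es ≡ j → total (e ∷ e′ ∷ es) ≡ triangle F →
                Built F (amount (e ∷ e′ ∷ es))
  atThreshold e e′ es len tot with extractLargest e (e′ ∷ es)
  ... | m , b , []     , σ , _ = contradiction (↭-length σ) (λ ())
  ... | m , b , x ∷ xs , σ , ≤b with extractSmallest x xs
  ...   | i , a , ys , τ , a≤ys =
    built-≗ (λ l → sym (amount-↭ perm l))
      (peel i m b ys len′ B≤b p a ℕₚ.≤-refl (ℕₚ.≤-trans a≤B peelable) (trans (sym (total-↭ perm)) tot))
    where
    perm : e ∷ e′ ∷ es ↭ (i , a) ∷ (m , b) ∷ ys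
    perm = ↭.trans σ (↭.trans (prep (m , b) τ) (swap (m , b) (i , a) ↭.refl))
    len′ : length ys ≡ j
    len′ = trans (ℕₚ.suc-injective (ℕₚ.suc-injective (sym (↭-length perm)))) len
    2*total : 2 * total (e ∷ e′ ∷ es) ≡ 2 * K * B
    2*total = trans (cong (2 *_) tot) average
    B≤b : B ≤ b
    B≤b = ℕₚ.*-cancelˡ-≤ (2 * K) (begin
      2 * K * B                    ≡⟨ 2*total ⟨
      2 * total (e ∷ e′ ∷ es)      ≡⟨ cong (2 *_) (total-↭ σ) ⟩
      2 * total ((m , b) ∷ x ∷ xs) ≤⟨ ℕₚ.*-monoʳ-≤ 2 (total-≤ {es = (m , b) ∷ x ∷ xs} (ℕₚ.≤-refl ∷ ≤b)) ⟩
      2 * (length ((m , b) ∷ x ∷ xs) * b) ≡⟨ cong (λ n → 2 * (n * b)) (trans (sym (↭-length σ)) (cong (2 +_) len)) ⟩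
      2 * (K * b)                  ≡⟨ ℕₚ.*-assoc 2 K b ⟨
      2 * K * b                    ∎)
    a≤b : a ≤ b
    a≤b with All-resp-↭ τ ≤b
    ... | a≤b ∷ _ = a≤b
    a≤B : a ≤ B
    a≤B = ℕₚ.*-cancelˡ-≤ (2 * K) (begin
      2 * K * a                    ≡⟨ ℕₚ.*-assoc 2 K a ⟩
      2 * (K * a)                  ≡⟨ cong (λ n → 2 * ((2 + n) * a)) len′ ⟨
      2 * (length ((i , a) ∷ (m , b) ∷ ys) * a) ≤⟨ ℕₚ.*-monoʳ-≤ 2 (total-≥ {es = (i , a) ∷ (m , b) ∷ ys} (ℕₚ.≤-refl ∷ a≤b ∷ a≤ys)) ⟩
      2 * total ((i , a) ∷ (m , b) ∷ ys) ≡⟨ cong (2 *_) (total-↭ perm) ⟨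
      2 * total (e ∷ e′ ∷ es)      ≡⟨ 2*total ⟩
      2 * K * B                    ∎)

  aboveThreshold : ∀ d (es : List (Fin k × ℕ)) → length es ≡ K → total es ≡ triangle (d + F) →
                   Built (d + F) (amount es)
  aboveThreshold zero    (e ∷ e′ ∷ es) len tot = atThreshold e e′ es (ℕₚ.suc-injective (ℕₚ.suc-injective len)) tot
  aboveThreshold (suc d) (e ∷ es) len tot = reduceByStar e es (d + F)
    (begin
      2 * suc (length es)  ≡⟨ cong (2 *_) len ⟩
      2 * K                ≤⟨ few-classes ⟩
      F                    ≤⟨ ℕₚ.m≤n+m F (suc d) ⟩
      suc (d + F)          ∎)
    tot
    (λ e′ es′ len′ tot′ → aboveThreshold d (e′ ∷ es′) (trans (cong suc len′) len) tot′)

-- With the slack `d` given explicitly, an inequality between polynomials becomes an identity for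
-- the ring solver.
≤-by : ∀ {x y} d → x + d ≡ y → x ≤ y
≤-by {x} d refl = ℕₚ.m≤m+n x d

-- In terms of the number K = 2 + j of classes: s = 4 K + 1,
-- r₀ = 8 K ² - 8 K - 2, p = 4 K + 2, F = 8 K ² + 1 and B = 4 K F.
built-large : ∀ j n (es : List (Fin k × ℕ)) → length es ≡ suc j → 8 * (suc j * suc j) + 1 ≤ n → total es ≡ triangle n →
              Built n (amount es)
-- With one class left, the complete graph is monochromatic; the second share of the two-colored
-- construction is zero.
built-large zero    (suc n) ((i , a) ∷ []) refl 9≤n tot =
  built-≗ (λ l → cong (single i a l +_) (single-0 i l)) (built-twoColored i i n a 0 tot)
built-large {k} (suc j) n es len large tot = subst (λ n → Built n (amount es)) n≡
  (aboveThreshold (n ∸ F) es len (trans tot (cong triangle (sym n≡))))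
  where
  s′ r₀ p Δ F B : ℕ
  s′ = 8 + 4 * j
  r₀ = 8 * (j * j) + 24 * j + 14
  p  = 10 + 4 * j
  Δ  = suc s′ * (4 + 2 * j)
  F  = suc s′ + (r₀ + p)
  B  = 4 * (2 + j) * (8 * ((2 + j) * (2 + j)) + 1)

  F≡ : ∀ j → 9 + 4 * j + (8 * (j * j) + 24 * j + 14 + (10 + 4 * j)) ≡ 8 * ((2 + j) * (2 + j)) + 1
  F≡ = solve-∀

  n≡ : n ∸ F + F ≡ n
  n≡ = ℕₚ.m∸n+n≡m (subst (_≤ n) (sym (F≡ j)) large)

  Δ≡ : triangle (suc s′) ≡ Δ
  Δ≡ = ℕₚ.*-cancelˡ-≡ _ _ 2 (trans (2*triangle s′) (poly j))
    where
    poly : ∀ j → (9 + 4 * j) * (8 + 4 * j) ≡ 2 * ((9 + 4 * j) * (4 + 2 * j))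
    poly = solve-∀

  block-fits : suc s′ * (r₀ + p) + Δ ≤ B
  block-fits = ≤-by (6 * (2 + j)) (poly j)
    where
    poly : ∀ j → (9 + 4 * j) * (8 * (j * j) + 24 * j + 14 + (10 + 4 * j)) + (9 + 4 * j) * (4 + 2 * j) + 6 * (2 + j)
                 ≡ 4 * (2 + j) * (8 * ((2 + j) * (2 + j)) + 1)
    poly = solve-∀

  star-fits : F ≤ suc Δ
  star-fits = ≤-by (4 + 2 * j) (poly j)
    where
    poly : ∀ j → 9 + 4 * j + (8 * (j * j) + 24 * j + 14 + (10 + 4 * j)) + (4 + 2 * j) ≡ suc ((9 + 4 * j) * (4 + 2 * j))
    poly = solve-∀

  peelable : B ≤ Δ + p * (suc s′ + r₀)
  peelable = ≤-by (8 * (j * j) + 18 * j + 2) (poly j)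
    where
    poly : ∀ j → 4 * (2 + j) * (8 * ((2 + j) * (2 + j)) + 1) + (8 * (j * j) + 18 * j + 2)
                 ≡ (9 + 4 * j) * (4 + 2 * j) + (10 + 4 * j) * (9 + 4 * j + (8 * (j * j) + 24 * j + 14))
    poly = solve-∀

  average : 2 * triangle F ≡ 2 * (2 + j) * B
  average = trans (2*triangle (s′ + (r₀ + p))) (poly j)
    where
    poly : ∀ j → (9 + 4 * j + (8 * (j * j) + 24 * j + 14 + (10 + 4 * j))) * (8 + 4 * j + (8 * (j * j) + 24 * j + 14 + (10 + 4 * j)))
                 ≡ 2 * (2 + j) * (4 * (2 + j) * (8 * ((2 + j) * (2 + j)) + 1))
    poly = solve-∀

  few-classes : 2 * (2 + j) ≤ F
  few-classes = ≤-by (8 * (j * j) + 30 * j + 29) (poly j)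
    where
    poly : ∀ j → 2 * (2 + j) + (8 * (j * j) + 30 * j + 29) ≡ 9 + 4 * j + (8 * (j * j) + 24 * j + 14 + (10 + 4 * j))
    poly = solve-∀

  -- The vertices outside the block are numerous enough for the induction hypothesis with one class
  -- fewer.
  threshold≤ : 8 * (suc j * suc j) + 1 ≤ r₀
  threshold≤ = ≤-by (8 * j + 5) (poly j)
    where
    poly : ∀ j → 8 * (suc j * suc j) + 1 + (8 * j + 5) ≡ 8 * (j * j) + 24 * j + 14
    poly = solve-∀

  open Step j s′ r₀ p B
    (subst (λ t → suc s′ * (r₀ + p) + t ≤ B) (sym Δ≡) block-fits)
    (subst (λ t → F ≤ suc t) (sym Δ≡) star-fits)
    (subst (λ t → B ≤ t + p * (suc s′ + r₀)) (sym Δ≡) peelable)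
    average few-classes
    {k} (λ r es len r₀≤r → built-large j r es len (ℕₚ.≤-trans threshold≤ r₀≤r))
    using (aboveThreshold)

-- From lists of classes to partitions

withColors : Vec ℕ k → List (Fin k × ℕ)
withColors []      = []
withColors (a ∷ e) = (zero , a) ∷ map (λ (j , b) → suc j , b) (withColors e)

length-withColors : (e : Vec ℕ k) → length (withColors e) ≡ k
length-withColors []      = refl
length-withColors (a ∷ e) = cong suc (trans (Listₚ.length-map _ (withColors e)) (length-withColors e))

total-withColors : (e : Vec ℕ k) → total (withColors e) ≡ Vec.sum e
total-withColors []      = refl
total-withColors (a ∷ e) = cong (a +_) (trans (total-suc (withColors e)) (total-withColors e))
  where
  total-suc : ∀ {k} (es : List (Fin k × ℕ)) → total (map (λ (j , b) → Fin.suc j , b) es) ≡ total es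
  total-suc []             = refl
  total-suc ((j , a) ∷ es) = cong (a +_) (total-suc es)

amount-withColors : (e : Vec ℕ k) → ∀ i → amount (withColors e) i ≡ lookup e i
amount-withColors (a ∷ e) zero    = trans (cong (a +_) (amount-zero (withColors e))) (ℕₚ.+-identityʳ a)
  where
  amount-zero : ∀ {k} (es : List (Fin k × ℕ)) → amount (map (λ (j , b) → Fin.suc j , b) es) zero ≡ 0
  amount-zero []             = refl
  amount-zero ((j , a) ∷ es) = amount-zero es
amount-withColors (a ∷ e) (suc i) = trans (amount-suc (withColors e) i) (amount-withColors e i)
  where
  amount-suc : ∀ {k} (es : List (Fin k × ℕ)) i → amount (map (λ (j , b) → Fin.suc j , b) es) (suc i) ≡ amount es i
  amount-suc []             i = refl
  amount-suc ((j , a) ∷ es) i = cong (single j a i +_) (amount-suc es i)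

realizable-large : ∀ k → RealizableFrom (suc k) (8 * (suc k * suc k) + 1)
realizable-large k n large e (_ , sum≡) = built⇒realizable e (built-≗ (amount-withColors e)
  (built-large k n (withColors e) (length-withColors e) large
    (trans (total-withColors e) (trans sum≡ (C2≡triangle n)))))

-- Search over joins

-- One result for each class that can afford `c` edges; the guard keeps the truncated subtraction
-- exact.
spend : ℕ → Vec ℕ k → List (Vec ℕ k)
spend c []      = []
spend c (a ∷ e) = (if c ≤ᵇ a then [ a ∸ c ∷ e ] else []) ++ map (a ∷_) (spend c e)

∈-spend : ∀ c (e : Vec ℕ k) {e′} → e′ ∈ spend c e → ∃[ j ] ∀ i → lookup e i ≡ single j c i + lookup e′ i
∈-spend c (a ∷ e) e′∈ with c ≤ᵇ a in eq
∈-spend c (a ∷ e) (here refl) | true = zero , λ { zero → sym (ℕₚ.m+[n∸m]≡n (ℕₚ.≤ᵇ⇒≤ c a (subst T (sym eq) tt))) ; (suc i) → refl }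
∈-spend c (a ∷ e) (there e′∈) | true with ∈-map⁻ (a ∷_) e′∈
... | e″ , e″∈ , refl with ∈-spend c e e″∈
...   | j , eq′ = suc j , λ { zero → refl ; (suc i) → eq′ i }
∈-spend c (a ∷ e) e′∈ | false with ∈-map⁻ (a ∷_) e′∈
... | e″ , e″∈ , refl with ∈-spend c e e″∈
...   | j , eq′ = suc j , λ { zero → refl ; (suc i) → eq′ i }

-- Stars with `s`, `s - 1`, ..., `1` edges together fill the complete graph on `suc s` vertices.
spendStars : ℕ → Vec ℕ k → List (Vec ℕ k)
spendStars zero    e = [ e ]
spendStars (suc s) e = concatMap (spendStars s) (spend (suc s) e)

∈-spendStars : ∀ s (e : Vec ℕ k) {e′} → e′ ∈ spendStars s e →
               ∃[ f ] Built (suc s) f × (∀ i → lookup e i ≡ f i + lookup e′ i)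
∈-spendStars zero    e (here refl) = (λ _ → 0) , built-leaf , λ _ → refl
∈-spendStars (suc s) e e′∈ with find (∈-concatMap⁻ (spendStars s) {xs = spend (suc s) e} e′∈)
... | e₁ , e₁∈ , e′∈ with ∈-spend (suc s) e e₁∈ | ∈-spendStars s e₁ e′∈
...   | j , eq₁ | f , built , eq₂ = _ , built-star j built , λ i →
        trans (eq₁ i) (trans (cong (single j (suc s) i +_) (eq₂ i)) (sym (ℕₚ.+-assoc (single j (suc s) i) _ _)))

-- What remains after splitting off a block of suc s vertices whose inner edges
-- are colored by stars.
split : (s r : ℕ) → Vec ℕ k → List (Vec ℕ k)
split s r e = concatMap (spendStars s) (spend (suc s * r) e)

∈-split : ∀ s r (e : Vec ℕ k) {e′} → e′ ∈ split s r e → Built r (lookup e′) → Built (suc s + r) (lookup e)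
∈-split s r e e′∈ rest with find (∈-concatMap⁻ (spendStars s) {xs = spend (suc s * r) e} e′∈)
... | e₁ , e₁∈ , e′∈ with ∈-spend (suc s * r) e e₁∈ | ∈-spendStars s e₁ e′∈
...   | j , eq₁ | f , built , eq₂ = built-≗
        (λ i → sym (trans (eq₁ i) (cong (single j (suc s * r) i +_) (eq₂ i))))
        (built-join j built rest)

-- Blocks of at most three vertices are split off, which is enough for the two base cases. Only a
-- positive answer is used.
search : ℕ → Vec ℕ k → Bool
search 0 e = false
search 1 e = Vec.sum e ≡ᵇ 0
search 2 e = any (search 1) (split 0 1 e)
search 3 e = any (search 2) (split 0 2 e)
search (suc r′@(suc r″@(suc r@(suc _)))) e =
  any (search r′) (split 0 r′ e) ∨ any (search r″) (split 1 r″ e) ∨ any (search r) (split 2 r e)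

sum≡0⇒lookup≡0 : (e : Vec ℕ k) → Vec.sum e ≡ 0 → ∀ i → lookup e i ≡ 0
sum≡0⇒lookup≡0 (0 ∷ e) eq zero    = refl
sum≡0⇒lookup≡0 (0 ∷ e) eq (suc i) = sum≡0⇒lookup≡0 e eq i

any-split : ∀ s r (p : Vec ℕ k → Bool) → (∀ e → T (p e) → Built r (lookup e)) →
            ∀ e → T (any p (split s r e)) → Built (suc s + r) (lookup e)
any-split s r p sound e q with find (Anyₚ.any⁻ p (split s r e) q)
... | e′ , e′∈ , pe′ = ∈-split s r e e′∈ (sound e′ pe′)

search-sound : ∀ n (e : Vec ℕ k) → T (search n e) → Built n (lookup e)
search-sound 1 e p = built-≗ (sym ∘ sum≡0⇒lookup≡0 e (ℕₚ.≡ᵇ⇒≡ (Vec.sum e) 0 p)) built-leaf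
search-sound 2 e p = any-split 0 1 (search 1) (search-sound 1) e p
search-sound 3 e p = any-split 0 2 (search 2) (search-sound 2) e p
search-sound (suc r′@(suc r″@(suc r@(suc _)))) e p =
  [ any-split 0 r′ (search r′) (search-sound r′) e
  , [ any-split 1 r″ (search r″) (search-sound r″) e
    , any-split 2 r (search r) (search-sound r) e ]′ ∘ Equivalence.to (Boolₚ.T-∨ {any (search r″) (split 1 r″ e)})
  ]′ (Equivalence.to (Boolₚ.T-∨ {any (search r′) (split 0 r′ e)}) p)

-- Exhaustive check of the base cases

incrementHead : Vec ℕ (suc k) → Vec ℕ (suc k)
incrementHead (a ∷ e) = suc a ∷ e

-- The first entry is either zero or the successor of a smaller one. Zero entries are included
-- because removing stars may empty a class.
allWithSum : ∀ k → ℕ → (Vec ℕ k → Bool) → Bool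
allWithSum zero    zero    p = p []
allWithSum zero    (suc S) p = true
allWithSum (suc k) zero    p = allWithSum k zero (p ∘ (0 ∷_))
allWithSum (suc k) (suc S) p = allWithSum k (suc S) (p ∘ (0 ∷_)) ∧ allWithSum (suc k) S (p ∘ incrementHead)

allWithSum-sound : ∀ k S (p : Vec ℕ k → Bool) → T (allWithSum k S p) → ∀ e → Vec.sum e ≡ S → T (p e)
allWithSum-sound zero    zero    p all []          eq = all
allWithSum-sound (suc k) zero    p all (zero ∷ e)  eq = allWithSum-sound k zero (p ∘ (0 ∷_)) all e eq
allWithSum-sound (suc k) (suc S) p all (zero ∷ e)  eq =
  allWithSum-sound k (suc S) (p ∘ (0 ∷_)) (proj₁ (Equivalence.to Boolₚ.T-∧ all)) e eq
allWithSum-sound (suc k) (suc S) p all (suc a ∷ e) eq =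
  allWithSum-sound (suc k) S (p ∘ incrementHead)
    (proj₂ (Equivalence.to (Boolₚ.T-∧ {allWithSum k (suc S) (p ∘ (0 ∷_))}) all)) (a ∷ e) (ℕₚ.suc-injective eq)

sum-tabulate-single : ∀ (j : Fin k) a f → Vec.sum (Vec.tabulate λ i → single j a i + f i) ≡ a + Vec.sum (Vec.tabulate f)
sum-tabulate-single zero    a f = ℕₚ.+-assoc a (f zero) _
sum-tabulate-single (suc j) a f =
  trans (cong (f zero +_) (sum-tabulate-single j a (f ∘ suc))) (swap-+ (f zero) a _)

sum-amount : (es : List (Fin k × ℕ)) → Vec.sum (Vec.tabulate (amount es)) ≡ total es
sum-amount {k} []             = sum-0 k
  where
  sum-0 : ∀ k → Vec.sum (Vec.tabulate {n = k} λ _ → 0) ≡ 0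
  sum-0 zero    = refl
  sum-0 (suc k) = sum-0 k
sum-amount ((j , a) ∷ es) = trans (sum-tabulate-single j a (amount es)) (cong (a +_) (sum-amount es))

-- Stars of a largest class reduce every larger `n` to `m`, where the hypothesis covers all size
-- vectors. For concrete `k` and `m` that hypothesis holds by evaluation.
realizableFrom-base : ∀ k m → 2 * suc k ≤ suc m → T (allWithSum (suc k) (triangle m) (search m)) → RealizableFrom (suc k) m
realizableFrom-base k m 2k≤m+1 all n m≤n e (_ , sum≡) = built⇒realizable e (built-≗ (amount-withColors e)
  (subst (λ n → Built n (amount (withColors e))) n≡
    (built (n ∸ m) (withColors e) (length-withColors e)
      (trans (total-withColors e) (trans sum≡ (trans (C2≡triangle n) (cong triangle (sym n≡))))))))
  where
  n≡ = ℕₚ.m∸n+n≡m m≤n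
  built : ∀ d (es : List (Fin (suc k) × ℕ)) → length es ≡ suc k → total es ≡ triangle (d + m) → Built (d + m) (amount es)
  built zero    es       len tot = built-≗ (Vecₚ.lookup∘tabulate (amount es)) (search-sound m (Vec.tabulate (amount es))
    (allWithSum-sound (suc k) (triangle m) (search m) all _ (trans (sum-amount es) tot)))
  built (suc d) (e ∷ es) len tot = reduceByStar e es (d + m)
    (subst (λ l → 2 * l ≤ suc (d + m)) (sym len) (ℕₚ.≤-trans 2k≤m+1 (s≤s (ℕₚ.m≤n+m m d)))) tot
    (λ e′ es′ len′ tot′ → built d (e′ ∷ es′) (trans (cong suc len′) len) tot′)

realizableFrom-3 : RealizableFrom 3 5
realizableFrom-3 = realizableFrom-base 2 5 ℕₚ.≤-refl tt

realizableFrom-4 : RealizableFrom 4 8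
realizableFrom-4 = realizableFrom-base 3 8 (ℕₚ.n≤1+n 8) tt

-- Connected colors

module _ (c : Coloring k n) (i : Fin k) where

  private col = color c

  degree-↭ : ∀ x {ys zs} → ys ↭ zs → degree col i x ys ≡ degree col i x zs
  degree-↭ x p = ↭-length (↭ₚ.filter-↭ (λ y → col x y ≟ i) p)

  degree-sym : ∀ x y → degree col i x [ y ] ≡ degree col i y [ x ]
  degree-sym x y rewrite symmetric c x y with does (col y x ≟ i)
  ... | true  = refl
  ... | false = refl

  pairCount-↭ : ∀ {xs ys} → xs ↭ ys → pairCount col i xs ≡ pairCount col i ys
  pairCount-↭ ↭.refl                      = refl
  pairCount-↭ (prep x p)                = cong₂ _+_ (degree-↭ x p) (pairCount-↭ p)
  pairCount-↭ (swap {xs} {ys} x y p)    = begin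
    deg x (y ∷ xs) + (deg y xs + pairCount col i xs)
      ≡⟨ cong₂ _+_ (degree-++ col i x [ y ] xs) (cong₂ _+_ (degree-↭ y p) (pairCount-↭ p)) ⟩
    (deg x [ y ] + deg x xs) + (deg y ys + pairCount col i ys)
      ≡⟨ cong (_+ (deg y ys + pairCount col i ys)) (cong₂ _+_ (degree-sym x y) (degree-↭ x p)) ⟩
    (deg y [ x ] + deg x ys) + (deg y ys + pairCount col i ys)
      ≡⟨ interchange-+ (deg y [ x ]) (deg x ys) (deg y ys) _ ⟩
    (deg y [ x ] + deg y ys) + (deg x ys + pairCount col i ys)
      ≡⟨ cong (_+ (deg x ys + pairCount col i ys)) (degree-++ col i y [ x ] ys) ⟨
    deg y (x ∷ ys) + (deg x ys + pairCount col i ys) ∎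
    where
    open ≡-Reasoning
    deg = degree col i
  pairCount-↭ (↭.trans p q)               = trans (pairCount-↭ p) (pairCount-↭ q)

module Gallai (c : Coloring k n) (gallai : IsGallai c) where

  col : Fin n → Fin n → Fin k
  col = color c

  -- If two of the vertices coincide, two of the three colors agree, so a rainbow triple is
  -- automatically a triangle.
  noRainbow : ∀ x y z → ¬ Rainbow c x y z
  noRainbow x y z rainbow@(p , q , r) = gallai x y z
    (λ { refl → q refl }) (λ { refl → r refl }) (λ { refl → p (symmetric c x y) }) rainbow

  -- Connectivity in color j is expressed by: every map that is constant along
  -- the edges of color j is constant.
  record Spanning (j : Fin k) (v : Fin n) (vs : List (Fin n)) : Set where
    field
      connected : (f : Fin n → Fin k) →
                  (∀ {x y} → x ∈ v ∷ vs → y ∈ v ∷ vs → col x y ≡ j → f x ≡ f y) →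
                  ∀ {x} → x ∈ vs → f x ≡ f v
      neighbour : ∀ {x} → x ∈ vs → ∃[ u ] u ∈ vs × col v u ≡ j
      enough    : length vs ≤ pairCount col j (v ∷ vs)

  open Spanning

  spanning-[] : ∀ j v → Spanning j v []
  spanning-[] j v = record { connected = λ _ _ () ; neighbour = λ () ; enough = z≤n }

  spanning-star : ∀ {j v vs} → (∀ {x} → x ∈ vs → col v x ≡ j) → Spanning j v vs
  spanning-star {j} {v} {vs} star = record
    { connected = λ f f-const x∈ → sym (f-const (here refl) (there x∈) (star x∈))
    ; neighbour = λ x∈ → _ , x∈ , star x∈
    ; enough    = ℕₚ.≤-trans
        (ℕₚ.≤-reflexive (sym (cong length (Listₚ.filter-all (λ y → col v y ≟ j) (All.tabulate star)))))
        (ℕₚ.m≤m+n (degree col j v vs) _)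
    }

  -- Otherwise `v`, `x`, `y` form a rainbow triangle. Hence `col v` is constant along edges of color
  -- `j` among vertices that `v` does not reach in color `j`.
  same-color : ∀ {j} v {x y} → col v x ≢ j → col v y ≢ j → col x y ≡ j → col v x ≡ col v y
  same-color v {x} {y} vx≢j vy≢j refl = decidable-stable (col v x ≟ col v y)
    λ vx≢vy → noRainbow v x y (vx≢j , vy≢j ∘ sym , vx≢vy)

  -- One edge of color `j` at `v` attaches `v` to the connected part. If there is none, `same-color`
  -- allows connectivity to be applied to the map `col v`, which is therefore constant.
  extend : ∀ {j u us} v → Spanning j u us → Spanning j v (u ∷ us) ⊎ (∀ {x} → x ∈ u ∷ us → col v x ≡ col v u)
  extend {j} {u} {us} v spanning with Any.any? (λ w → col v w ≟ j) (u ∷ us)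
  ... | yes vw≡j = inj₁ record
    { connected = λ f f-const x∈ →
        let toU : ∀ {x} → x ∈ u ∷ us → f x ≡ f u
            toU = λ { (here refl)  → refl
                    ; (there x∈us) → connected spanning f (λ x∈ y∈ → f-const (there x∈) (there y∈)) x∈us }
            w , w∈ , vw≡j = find vw≡j
        in trans (toU x∈) (trans (sym (toU w∈)) (sym (f-const (here refl) (there w∈) vw≡j)))
    ; neighbour = λ _ → find vw≡j
    ; enough    = ℕₚ.+-mono-≤ (Listₚ.filter-some (λ w → col v w ≟ j) vw≡j) (enough spanning)
    }
  ... | no ¬vw≡j = inj₂ λ
    { (here refl)  → refl
    ; (there x∈us) → connected spanning (col v)
        (λ x∈ y∈ → same-color v (¬vw≡j ∘ lose x∈) (¬vw≡j ∘ lose y∈)) x∈us }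

  -- Vertices are added one at a time: either the old color still connects everything, or the new
  -- vertex is the center of a spanning monochromatic star.
  exists-spanning : ∀ v vs → ∃[ j ] Spanning j v vs
  exists-spanning v []       = col v v , spanning-[] _ v
  exists-spanning v (u ∷ us) with exists-spanning u us
  ... | j , spanning with extend v spanning
  ...   | inj₁ spanning′ = j , spanning′
  ...   | inj₂ star      = col v u , spanning-star star

  -- Both sides are nonempty, so a cut says that the edges of colors other than `p` do not connect
  -- `v ∷ vs`.
  Cut : Fin k → Fin n → List (Fin n) → Set
  Cut p v vs = ∃[ as ] ∃[ b ] ∃[ bs ] (vs ↭ as ++ b ∷ bs) ×
               (∀ {x y} → x ∈ v ∷ as → y ∈ b ∷ bs → col x y ≡ p)

  -- All of `ys` can join the side of `v`, because the other side lies in `xs` and meets `ys` only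
  -- in color `p`.
  cut-++ : ∀ {p v vs xs ys} → vs ↭ xs ++ ys → (∀ {x y} → x ∈ xs → y ∈ ys → col x y ≡ p) → Cut p v xs → Cut p v vs
  cut-++ {p} {v} {vs} {xs} {ys} σ xs-ys (as , b , bs , τ , cross) = as ++ ys , b , bs , perm , cross′
    where
    open PermutationReasoning
    perm : vs ↭ (as ++ ys) ++ b ∷ bs
    perm = begin
      vs                     ↭⟨ σ ⟩
      xs ++ ys               ↭⟨ ↭ₚ.++⁺ʳ ys τ ⟩
      (as ++ b ∷ bs) ++ ys   ≡⟨ Listₚ.++-assoc as (b ∷ bs) ys ⟩
      as ++ (b ∷ bs) ++ ys   ↭⟨ ↭ₚ.++⁺ˡ as (↭ₚ.++-comm (b ∷ bs) ys) ⟩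
      as ++ ys ++ b ∷ bs     ≡⟨ Listₚ.++-assoc as ys (b ∷ bs) ⟨
      (as ++ ys) ++ b ∷ bs   ∎
    cross′ : ∀ {x y} → x ∈ v ∷ as ++ ys → y ∈ b ∷ bs → col x y ≡ p
    cross′ (here refl) y∈ = cross (here refl) y∈
    cross′ {x} {y} (there x∈) y∈ with ∈-++⁻ as x∈
    ... | inj₁ x∈as = cross (there x∈as) y∈
    ... | inj₂ x∈ys = trans (symmetric c x y) (xs-ys (∈-resp-↭ (↭-sym τ) (∈-++⁺ʳ as y∈)) x∈ys)

  -- The two spanning colors are equal because a neighbour of v in xs and one in
  -- ys form a triangle with v whose third edge has color p.
  glue : ∀ {p a b v vs x xs y ys} → vs ↭ x ∷ xs ++ y ∷ ys →
         (∀ {x′ y′} → x′ ∈ x ∷ xs → y′ ∈ y ∷ ys → col x′ y′ ≡ p) → a ≢ p → b ≢ p →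
         Spanning a v (x ∷ xs) → Spanning b v (y ∷ ys) → Spanning a v vs
  glue {p} {a} {b} {v} {vs} {x} {xs} {y} {ys} σ cross a≢p b≢p spanX spanY
    with neighbour spanX (here refl) | neighbour spanY (here refl)
  ... | u , u∈ , refl | w , w∈ , refl with same-color v a≢p b≢p (cross u∈ w∈)
  ...   | vu≡vw = record
    { connected = λ f f-const z∈ →
        [ connected spanX f (λ s t → f-const (inX s) (inX t))
        , connected spanY f (λ s t → f-const (inY s) (inY t) ∘ flip trans (sym vu≡vw))
        ]′ (∈-++⁻ (x ∷ xs) (∈-resp-↭ σ z∈))
    ; neighbour = λ _ → u , ∈-resp-↭ (↭-sym σ) (∈-++⁺ˡ u∈) , refl
    ; enough = begin
        length vs                                ≡⟨ ↭-length σ ⟩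
        length (X ++ Y)                          ≡⟨ Listₚ.length-++ X ⟩
        length X + length Y                      ≤⟨ ℕₚ.+-mono-≤ (enough spanX)
                                                      (subst (λ l → length Y ≤ pairCount col l (v ∷ Y)) (sym vu≡vw) (enough spanY)) ⟩
        (deg X + count′ X) + (deg Y + count′ Y)  ≡⟨ interchange-+ (deg X) _ _ _ ⟩
        (deg X + deg Y) + (count′ X + count′ Y)  ≤⟨ ℕₚ.+-monoʳ-≤ (deg X + deg Y) (ℕₚ.m≤n+m _ (crossCount col (col v u) X Y)) ⟩
        (deg X + deg Y) + (crossCount col (col v u) X Y + (count′ X + count′ Y))
          ≡⟨ cong₂ _+_ (degree-++ col (col v u) v X Y) (pairCount-++ col (col v u) X Y) ⟨
        pairCount col (col v u) (v ∷ X ++ Y)     ≡⟨ pairCount-↭ c (col v u) (prep v σ) ⟨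
        pairCount col (col v u) (v ∷ vs)         ∎
    }
    where
    open ℕₚ.≤-Reasoning
    X = x ∷ xs
    Y = y ∷ ys
    deg count′ : List (Fin n) → ℕ
    deg    = degree col (col v u) v
    count′ = pairCount col (col v u)
    inX : ∀ {z} → z ∈ v ∷ X → z ∈ v ∷ vs
    inX (here eq)  = here eq
    inX (there z∈) = there (∈-resp-↭ (↭-sym σ) (∈-++⁺ˡ z∈))
    inY : ∀ {z} → z ∈ v ∷ Y → z ∈ v ∷ vs
    inY (here eq)  = here eq
    inY (there z∈) = there (∈-resp-↭ (↭-sym σ) (∈-++⁺ʳ X z∈))

  module _ {p q : Fin k} (q≢p : q ≢ p) where

    -- Induction on the number of vertices, bounded by `m`. If a color other than `p` spans the
    -- vertices without `v`, then `extend` applies. If they have a cut, `v` is added to each side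
    -- separately: a cut of either enlarged side extends to everything, and otherwise `glue` merges
    -- the two spanning colors.
    cut-or-spanning : ∀ m v vs → length vs ≤ m → Cut p v vs ⊎ (∃[ j ] j ≢ p × Spanning j v vs)
    -- Every color spans a single vertex; `q` supplies one other than `p`.
    cut-or-spanning m       v []       _ = inj₂ (q , q≢p , spanning-[] q v)
    cut-or-spanning (suc m) v (u ∷ us) (s≤s us≤m) with cut-or-spanning m u us us≤m
    ... | inj₂ (j , j≢p , spanning) with extend v spanning
    ...   | inj₁ spanning′ = inj₂ (j , j≢p , spanning′)
    ...   | inj₂ star with col v u ≟ p
    ...     | no vu≢p  = inj₂ (col v u , vu≢p , spanning-star star)
    -- All edges at `v` have color `p`, so `v` alone is one side of a cut.
    ...     | yes vu≡p = inj₁ ([] , u , us , ↭.refl , λ { (here refl) y∈ → trans (star y∈) vu≡p })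
    cut-or-spanning (suc m) v (u ∷ us) (s≤s us≤m) | inj₁ (as , b , bs , σ , cross)
      with cut-or-spanning m v (u ∷ as) (ℕₚ.≤-trans X≤us us≤m) | cut-or-spanning m v (b ∷ bs) (ℕₚ.≤-trans Y≤us us≤m)
      where
      us≡ : length us ≡ length as + suc (length bs)
      us≡ = trans (↭-length σ) (Listₚ.length-++ as)
      X≤us : suc (length as) ≤ length us
      X≤us = subst (suc (length as) ≤_) (trans (sym (ℕₚ.+-suc (length as) (length bs))) (sym us≡))
                   (ℕₚ.m≤m+n (suc (length as)) (length bs))
      Y≤us : suc (length bs) ≤ length us
      Y≤us = subst (suc (length bs) ≤_) (sym us≡) (ℕₚ.m≤n+m (suc (length bs)) (length as))
    ... | inj₁ cut | _        = inj₁ (cut-++ (prep u σ) cross cut)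
    ... | inj₂ _   | inj₁ cut = inj₁ (cut-++ (↭-trans (prep u σ) (↭ₚ.++-comm (u ∷ as) (b ∷ bs)))
                                             (λ {x} {y} x∈ y∈ → trans (symmetric c x y) (cross y∈ x∈)) cut)
    ... | inj₂ (a , a≢p , spanX) | inj₂ (l , l≢p , spanY) = inj₂ (a , a≢p , glue (prep u σ) cross a≢p l≢p spanX spanY)

-- Unrealizable sizes

connectedColor : ∀ {n} (c : Coloring k (suc n)) → IsGallai c → ∃[ j ] n ≤ edgeCount c j
connectedColor {n = n} c gallai with Gallai.exists-spanning c gallai zero (tabulate suc)
... | j , spanning = j , subst (n ≤_) (sym (edgeCount-pairCount c j))
                       (subst (_≤ pairCount (color c) j (zero ∷ tabulate suc)) (Listₚ.length-tabulate {n = n} suc) (Gallai.Spanning.enough spanning))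

unrealizable-small : ∀ {n} (e : Vec ℕ k) → (∀ i → lookup e i < n) → ¬ Realizable (suc n) e
unrealizable-small e e<n (c , gallai , counts) with connectedColor c gallai
... | j , n≤ = ℕₚ.<⇒≱ (e<n j) (subst (_ ≤_) (counts j) n≤)

-- A class of size 4 is too small to span seven vertices, so the class of size 9 contains a cut.
-- Cuts have 6, 10 or 12 edges, and only 6 is affordable: one vertex is cut off. The other six
-- vertices have classes of sizes 3, 4, 4, 4, whereas a connected color there needs 5 edges.
unrealizable-9444 : ¬ Realizable 7 (9 ∷ 4 ∷ 4 ∷ 4 ∷ [])
unrealizable-9444 (c , gallai , counts)
  with cut-or-spanning {q = suc zero} (λ ()) 6 zero (tabulate suc) ℕₚ.≤-refl
  where open Gallai c gallai
... | inj₂ (j , j≢0 , spanning) = absurd j j≢0 (subst (6 ≤_)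
        (trans (sym (edgeCount-pairCount c j)) (counts j)) (Gallai.Spanning.enough spanning))
  where
  absurd : ∀ j → j ≢ zero → ¬ 6 ≤ lookup (9 ∷ 4 ∷ 4 ∷ 4 ∷ []) j
  absurd zero                   j≢0 _ = j≢0 refl
  absurd (suc zero)             _   (s≤s (s≤s (s≤s (s≤s ()))))
  absurd (suc (suc zero))       _   (s≤s (s≤s (s≤s (s≤s ()))))
  absurd (suc (suc (suc zero))) _   (s≤s (s≤s (s≤s (s≤s ()))))
... | inj₁ (as , b , bs , σ , cross) = impossible (length as) (length bs) lengths decompose
        (exists-spanning′ zero as) (exists-spanning′ b bs)
  where
  open Gallai c gallai
  inA inB : Fin 4 → ℕ
  inA j = pairCount col j (zero ∷ as)
  inB j = pairCount col j (b ∷ bs)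
  exists-spanning′ : ∀ v vs → ∃[ j ] length vs ≤ pairCount col j (v ∷ vs)
  exists-spanning′ v vs with exists-spanning v vs
  ... | j , spanning = j , Spanning.enough spanning
  lengths : length as + length bs ≡ 5
  lengths = ℕₚ.suc-injective (trans (sym (ℕₚ.+-suc (length as) (length bs)))
                                     (sym (trans (↭-length σ) (Listₚ.length-++ as))))
  decompose : ∀ j → lookup (9 ∷ 4 ∷ 4 ∷ 4 ∷ []) j ≡ single zero (suc (length as) * suc (length bs)) j + (inA j + inB j)
  decompose j = begin
    lookup (9 ∷ 4 ∷ 4 ∷ 4 ∷ []) j                  ≡⟨ counts j ⟨
    edgeCount c j                                  ≡⟨ edgeCount-pairCount c j ⟩
    pairCount col j (allFin 7)                     ≡⟨ pairCount-↭ c j (prep zero σ) ⟩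
    pairCount col j ((zero ∷ as) ++ b ∷ bs)        ≡⟨ pairCount-++ col j (zero ∷ as) (b ∷ bs) ⟩
    crossCount col j (zero ∷ as) (b ∷ bs) + (inA j + inB j)
      ≡⟨ cong (_+ (inA j + inB j)) (crossCount-const col j zero (zero ∷ as) (b ∷ bs)
           (All.tabulate λ x∈ → All.tabulate λ y∈ → cross x∈ y∈)) ⟩
    single zero (suc (length as) * suc (length bs)) j + (inA j + inB j) ∎
    where open ≡-Reasoning
  rest≤4 : ∀ j {m} → lookup (9 ∷ 4 ∷ 4 ∷ 4 ∷ []) j ≡ single zero 6 j + m → m ≤ 4
  rest≤4 zero                   {3} refl = ℕₚ.n≤1+n 3
  rest≤4 (suc zero)             refl = ℕₚ.≤-refl
  rest≤4 (suc (suc zero))       refl = ℕₚ.≤-refl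
  rest≤4 (suc (suc (suc zero))) refl = ℕₚ.≤-refl
  impossible : ∀ a b → a + b ≡ 5 →
               (∀ j → lookup (9 ∷ 4 ∷ 4 ∷ 4 ∷ []) j ≡ single zero (suc a * suc b) j + (inA j + inB j)) →
               ∃[ j ] a ≤ inA j → ∃[ j ] b ≤ inB j → ⊥
  impossible 0 5 refl eq _ (j , 5≤) = ℕₚ.<⇒≱ 5≤ (ℕₚ.≤-trans (ℕₚ.m≤n+m (inB j) (inA j)) (rest≤4 j (eq j)))
  impossible 5 0 refl eq (j , 5≤) _ = ℕₚ.<⇒≱ 5≤ (ℕₚ.≤-trans (ℕₚ.m≤m+n (inA j) (inB j)) (rest≤4 j (eq j)))
  impossible 1 4 refl eq _ _ with () ← eq zero
  impossible 2 3 refl eq _ _ with () ← eq zero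
  impossible 3 2 refl eq _ _ with () ← eq zero
  impossible 4 1 refl eq _ _ with () ← eq zero

-- Existence of g(k)

pairCount-cong : {c d : Fin n → Fin n → Fin k} → (∀ x y → c x y ≡ d x y) → ∀ i xs → pairCount c i xs ≡ pairCount d i xs
pairCount-cong {c = c} {d} c≗d i xs =
  trans (sym (pairCount-map c d id i c≗d xs)) (cong (pairCount d i) (Listₚ.map-id xs))

-- `Realizable` for a bare color function, so that each decoded function can be tested and replaced
-- by a pointwise equal one.
IsRealization : Vec ℕ k → (Fin n → Fin n → Fin k) → Set
IsRealization {n = n} e c =
  (∀ x y → c x y ≡ c y x) ×
  (∀ x y z → x ≢ y → y ≢ z → x ≢ z → ¬ (c x y ≢ c y z × c y z ≢ c x z × c x y ≢ c x z)) ×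
  (∀ i → pairCount c i (allFin n) ≡ lookup e i)

isRealization? : (e : Vec ℕ k) (c : Fin n → Fin n → Fin k) → Dec (IsRealization e c)
isRealization? e c =
  Finₚ.all? (λ x → Finₚ.all? λ y → c x y ≟ c y x) ×-dec
  Finₚ.all? (λ x → Finₚ.all? λ y → Finₚ.all? λ z →
    ¬? (x ≟ y) →-dec ¬? (y ≟ z) →-dec ¬? (x ≟ z) →-dec
    ¬? (¬? (c x y ≟ c y z) ×-dec ¬? (c y z ≟ c x z) ×-dec ¬? (c x y ≟ c x z))) ×-dec
  Finₚ.all? (λ i → pairCount c i (allFin _) ℕₚ.≟ lookup e i)

isRealization-cong : {c d : Fin n → Fin n → Fin k} → (∀ x y → c x y ≡ d x y) → ∀ e → IsRealization e c → IsRealization e d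
isRealization-cong {c = c} {d} c≗d e (symm , gallai , counts) =
  (λ x y → trans (sym (c≗d x y)) (trans (symm x y) (c≗d y x))) ,
  (λ x y z x≢y y≢z x≢z (p , q , r) → gallai x y z x≢y y≢z x≢z
    (p ∘ convert (c≗d x y) (c≗d y z) , q ∘ convert (c≗d y z) (c≗d x z) , r ∘ convert (c≗d x y) (c≗d x z))) ,
  λ i → trans (sym (pairCount-cong c≗d i (allFin _))) (counts i)
  where
  convert : ∀ {a a′ b b′ : Fin _} → a ≡ a′ → b ≡ b′ → a ≡ b → a′ ≡ b′
  convert refl refl eq = eq

-- All `(k ^ n) ^ n` color functions are tested. Decoding the code of a function gives it back only
-- pointwise, hence `isRealization-cong`.
realizable? : ∀ n (e : Vec ℕ k) → Dec (Realizable n e)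
realizable? {k} n e = map′
  (λ (code , symm , gallai , counts) →
    let c = record { color = decode code ; symmetric = symm } in
    c , gallai , λ i → trans (edgeCount-pairCount c i) (counts i))
  (λ (c , gallai , counts) → encode (color c) , isRealization-cong (decode-encode (color c)) e
    (symmetric c , gallai , λ i → trans (sym (edgeCount-pairCount c i)) (counts i)))
  (Finₚ.any? (isRealization? e ∘ decode))
  where
  decode : Fin ((k ^ n) ^ n) → Fin n → Fin n → Fin k
  decode code x = finToFun (finToFun code x)
  encode : (Fin n → Fin n → Fin k) → Fin ((k ^ n) ^ n)
  encode c = funToFin (λ x → funToFin (c x))
  decode-encode : ∀ c x y → c x y ≡ decode (encode c) x y
  decode-encode c x y = sym (trans (cong (λ z → finToFun z y) (Finₚ.finToFun-funToFin (λ x → funToFin (c x)) x))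
                                   (Finₚ.finToFun-funToFin (c x) y))

lookup≤sum : (e : Vec ℕ k) → ∀ i → lookup e i ≤ Vec.sum e
lookup≤sum (a ∷ e) zero    = ℕₚ.m≤m+n a _
lookup≤sum (a ∷ e) (suc i) = ℕₚ.≤-trans (lookup≤sum e i) (ℕₚ.m≤n+m _ a)

AllRealizable : ℕ → ℕ → Set
AllRealizable k n = (e : Vec ℕ k) → IsPartition (n C 2) e → Realizable n e

-- The entries of a partition of `N` are at most `N`, so `suc N ^ k` candidate vectors suffice.
allRealizable? : ∀ k n → Dec (AllRealizable k n)
allRealizable? k n = map′
  (λ all e e-partition → subst (Realizable n) (sym (decode-encode e (proj₂ e-partition)))
    (all (encode e (proj₂ e-partition)) (subst (IsPartition N) (decode-encode e (proj₂ e-partition)) e-partition)))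
  (λ all code → all (decode code))
  (Finₚ.all? λ code → (VecAll.all? (0 ℕₚ.<?_) (decode code) ×-dec (Vec.sum (decode code) ℕₚ.≟ N))
                      →-dec realizable? n (decode code))
  where
  N = n C 2
  decode : Fin (suc N ^ k) → Vec ℕ k
  decode code = Vec.tabulate (toℕ ∘ finToFun code)
  bounded : (e : Vec ℕ k) → Vec.sum e ≡ N → ∀ i → lookup e i < suc N
  bounded e sum≡ i = s≤s (subst (lookup e i ≤_) sum≡ (lookup≤sum e i))
  encode : (e : Vec ℕ k) → Vec.sum e ≡ N → Fin (suc N ^ k)
  encode e sum≡ = funToFin (λ i → fromℕ< (bounded e sum≡ i))
  decode-encode : ∀ e sum≡ → e ≡ decode (encode e sum≡)
  decode-encode e sum≡ = trans (sym (Vecₚ.tabulate∘lookup e)) (Vecₚ.tabulate-cong λ i → sym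
    (trans (cong toℕ (Finₚ.finToFun-funToFin (λ i → fromℕ< (bounded e sum≡ i)) i)) (Finₚ.toℕ-fromℕ< (bounded e sum≡ i))))

-- The bound is lowered as long as the next smaller number of vertices is also good, and stops at
-- the first failure or at 1.
isG-below : ∀ k m → RealizableFrom k (suc m) → ∃[ g ] IsG k g × g ≤ suc m
isG-below k zero    real = 1 , record { positive = z<s ; realizable = real ; least = λ _ 0<m′ _ → 0<m′ } , ℕₚ.≤-refl
isG-below k (suc m) real with allRealizable? k (suc m)
... | no ¬all = 2 + m , record
  { positive   = z<s
  ; realizable = real
  ; least      = λ m′ _ real′ → ℕₚ.≰⇒> λ m′≤ → ¬all (real′ (suc m) m′≤)
  } , ℕₚ.≤-refl
... | yes all with isG-below k m (λ n m<n → [ real n , (λ { refl → all }) ]′ (ℕₚ.m≤n⇒m<n∨m≡n m<n))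
...   | g , isG , g≤ = g , isG , ℕₚ.m≤n⇒m≤1+n g≤

-- Bounds and exact values of g(k)

unrealizable⇒< : ∀ {e : Vec ℕ k} → IsPartition (n C 2) e → ¬ Realizable n e → ∀ m → RealizableFrom k m → n < m
unrealizable⇒< {n = n} {e} partition ¬real m real = ℕₚ.≰⇒> λ m≤n → ¬real (real n m≤n e partition)

isG-suc : ∀ {e : Vec ℕ k} → RealizableFrom k (suc n) → IsPartition (n C 2) e → ¬ Realizable n e → IsG k (suc n)
isG-suc real partition ¬real = record
  { positive = z<s ; realizable = real ; least = λ m′ _ → unrealizable⇒< partition ¬real m′ }

-- (1, n - 2, …, n - 2) for n = 2 k - 3 and k = 3 + j.
lowPartition : ∀ j → Vec ℕ (3 + j)
lowPartition j = 1 ∷ Vec.replicate (2 + j) (1 + 2 * j)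

lowPartition-isPartition : ∀ j → IsPartition ((3 + 2 * j) C 2) (lowPartition j)
lowPartition-isPartition j = z<s ∷ all-replicate (2 + j) , ℕₚ.*-cancelˡ-≡ _ _ 2 (begin
  2 * (1 + Vec.sum (Vec.replicate (2 + j) (1 + 2 * j))) ≡⟨ cong (λ x → 2 * (1 + x)) (sum-replicate (2 + j) (1 + 2 * j)) ⟩
  2 * (1 + (2 + j) * (1 + 2 * j))                       ≡⟨ poly j ⟩
  (3 + 2 * j) * (2 + 2 * j)                             ≡⟨ 2*triangle (2 + 2 * j) ⟨
  2 * triangle (3 + 2 * j)                              ≡⟨ cong (2 *_) (C2≡triangle (3 + 2 * j)) ⟨
  2 * ((3 + 2 * j) C 2)                                 ∎)
  where
  open ≡-Reasoning
  all-replicate : ∀ m → VecAll.All (0 <_) (Vec.replicate m (1 + 2 * j))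
  all-replicate zero    = []
  all-replicate (suc m) = z<s ∷ all-replicate m
  sum-replicate : ∀ m a → Vec.sum (Vec.replicate m a) ≡ m * a
  sum-replicate zero    a = refl
  sum-replicate (suc m) a = cong (a +_) (sum-replicate m a)
  poly : ∀ j → 2 * (1 + (2 + j) * (1 + 2 * j)) ≡ (3 + 2 * j) * (2 + 2 * j)
  poly = solve-∀

-- Even the largest class is one edge short of a spanning tree.
lowPartition-unrealizable : ∀ j → ¬ Realizable (3 + 2 * j) (lowPartition j)
lowPartition-unrealizable j = unrealizable-small (lowPartition j) λ
  { zero    → s≤s (s≤s z≤n)
  ; (suc i) → subst (_< 2 + 2 * j) (sym (Vecₚ.lookup-replicate i (1 + 2 * j))) ℕₚ.≤-refl }

existsG : ∀ k N → RealizableFrom k (suc N) → ∀ {l e} → IsPartition (l C 2) e → ¬ Realizable l e →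
          ∃[ m ] (IsG k m × suc l ≤ m × m ≤ suc N)
existsG k N real partition ¬real with isG-below k N real
... | m , isG , m≤ = m , isG , unrealizable⇒< partition ¬real m (IsG.realizable isG) , m≤

bounds : ∀ k → 3 ≤ k → ∃[ m ] (IsG k m × 2 * k ∸ 2 ≤ m × m ≤ 8 * k ^ 2 + 1)
bounds (suc (suc (suc j))) (s≤s (s≤s (s≤s _))) =
  m , isG , subst (_≤ m) (sym (cong (_∸ 2) (low j))) l≤ , subst (m ≤_) (high (3 + j)) ≤h
  where
  low : ∀ j → 2 * (3 + j) ≡ 2 + (4 + 2 * j)
  low = solve-∀
  high : ∀ k → suc (8 * (k * k)) ≡ 8 * k ^ 2 + 1
  high k = trans (ℕₚ.+-comm 1 (8 * (k * k))) (cong (λ x → 8 * (k * x) + 1) (sym (ℕₚ.*-identityʳ k)))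
  g = existsG (3 + j) (8 * ((3 + j) * (3 + j)))
        (subst (RealizableFrom (3 + j)) (ℕₚ.+-comm (8 * ((3 + j) * (3 + j))) 1) (realizable-large (2 + j)))
        {3 + 2 * j} (lowPartition-isPartition j) (lowPartition-unrealizable j)
  m   = proj₁ g
  isG = proj₁ (proj₂ g)
  l≤  = proj₁ (proj₂ (proj₂ g))
  ≤h  = proj₂ (proj₂ (proj₂ g))

unrealizable-222 : ¬ Realizable 4 (2 ∷ 2 ∷ 2 ∷ [])
unrealizable-222 = unrealizable-small (2 ∷ 2 ∷ 2 ∷ []) λ
  { zero → ℕₚ.≤-refl ; (suc zero) → ℕₚ.≤-refl ; (suc (suc zero)) → ℕₚ.≤-refl }

theorem5 :
    (∀ (k : ℕ) → 3 ≤ k →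
      ∃[ m ] (IsG k m × 2 * k ∸ 2 ≤ m × m ≤ 8 * k ^ 2 + 1))
    × IsG 3 5
    × IsG 4 8
theorem5 = bounds
  , isG-suc realizableFrom-3 (z<s ∷ z<s ∷ z<s ∷ [] , refl) unrealizable-222
  , isG-suc realizableFrom-4 (z<s ∷ z<s ∷ z<s ∷ z<s ∷ [] , refl) unrealizable-9444
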